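{- Let $p$ be an odd prime number and let $S$ be a zero-sum free sequence of elements of $\mathbb{Z}/p\mathbb{Z}$, of length $|S|$. Then for every positive integer $k$, there is an element of $S$ whose multiplicity in $S$ is at least \[\left\lceil\frac{2}{k}|S|-\frac{2}{k(k+1)}(p-1)\right\rceil.\]
   Context: A sequence $S=(s_1,\dots,s_n)$ in $\mathbb{Z}/p\mathbb{Z}$ (repetitions allowed) has length $|S|=n$; it is zero-sum free if $0\notin\{\sum_{i\in I}s_i:\emptyset\neq I\subset[1,n]\}$. -}

module Defs where

open import Data.Nat using (ℕ; zero; suc; _+_; _*_; _%_; NonZero)
open import Data.Nat.DivMod using (m%n<n)
open import Data.Fin using (Fin; fromℕ<; toℕ)
open import Data.Fin.Subset using (Subset; _∈_; Nonempty)
open import Data.Bool using (Bool; true; false)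
open import Data.Vec using (Vec; []; _∷_)
open import Data.List using (List; length; filter)
open import Data.Fin.Properties using (_≟_)
open import Relation.Binary.PropositionalEquality using (_≡_)
open import Relation.Nullary using (¬_)

_+ₚ_ : {p : ℕ} .{{_ : NonZero p}} → Fin p → Fin p → Fin p
_+ₚ_ {p} a b = fromℕ< (m%n<n (toℕ a + toℕ b) p)

0ₚ : {p : ℕ} .{{_ : NonZero p}} → Fin p
0ₚ {p} = fromℕ< (m%n<n 0 p)

subsum : {p n : ℕ} .{{_ : NonZero p}} → Vec (Fin p) n → Subset n → Fin p
subsum [] [] = 0ₚ
subsum (x ∷ xs) (true ∷ I) = x +ₚ subsum xs I
subsum (x ∷ xs) (false ∷ I) = subsum xs I

ZeroSumFree : {p n : ℕ} .{{_ : NonZero p}} → Vec (Fin p) n → Set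
ZeroSumFree {n = n} S = (I : Subset n) → Nonempty I → ¬ (subsum S I ≡ 0ₚ)

mult : {p n : ℕ} → Fin p → Vec (Fin p) n → ℕ
mult x [] = 0
mult x (y ∷ ys) with x ≟ y
... | Relation.Nullary.yes _ = suc (mult x ys)
... | Relation.Nullary.no _ = mult x ys

{-# OPTIONS --safe #-}

-- Split S into m sets A₁, …, Aₘ, where m is the largest multiplicity, and let dᵢ = |Aᵢ|.
-- It is enough to show ∑ dᵢ(dᵢ+1)/2 ≤ p - 1: since (d - k)(d - k - 1) ≥ 0, this sum is at
-- least (k+1)|S| - m k(k+1)/2.
--
-- Lift the elements of S to ℤ. For a set A = {a₁, …, a_d} consider
--   ∑ ε₁⋯ε_d V(ε₁a₁, …, ε_da_d) (ε₁a₁ + ⋯ + ε_da_d)^k   over all signs ε,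
-- where V is the Vandermonde determinant. V(x)(∑ x)^k is a combination of alternants
-- det(x_j^{m_i}) with ∑ mᵢ = d(d-1)/2 + k, and the signed sum kills an alternant unless all
-- mᵢ are odd; being distinct, they then have sum at least d². So the signed sum is 0 for
-- k < d(d+1)/2. Multiplying the weights of A₁, …, Aₘ gives a signed sum over all sign choices
-- for S that kills every polynomial f of degree less than N = ∑ dᵢ(dᵢ+1)/2, evaluated at the
-- signed sums z of S. With σ the sum of S, z + σ is twice a subsum, hence nonzero modulo p
-- except for the all-minus choice. If N ≥ p, take f(z) = ∏_{0<r<p} (z + σ - r): modulo p only
-- the all-minus term survives, and it is (p-1)! times Vandermonde determinants of distinct
-- residues, up to sign, a contradiction.
module Submission where

open import Defs
open import Data.Fin using (Fin)
open import Data.List using (map; length; concat)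
import Data.List.Properties as List
open import Data.List.Relation.Binary.Permutation.Propositional.Properties using (↭-length)
import Data.Nat.Properties as ℕ
open import Data.Nat.Primality using (Prime)
open import Data.Product using (∃; _×_; _,_)
open import Data.Vec using (Vec; toList)
import Data.Vec.Properties as Vec
open import Relation.Binary.PropositionalEquality using (_≡_; _≢_; sym; trans; cong)

module SignedSums where

  open import Data.Bool using (true; false)
  import Data.Fin as Fin
  open import Data.Fin using (toℕ)
  import Data.Fin.Properties as Fin
  open import Data.Fin.Subset using (Nonempty)
  open import Data.Integer as ℤ using (ℤ; +_; -_; _+_; _*_; _-_; _^_; 0ℤ; 1ℤ; -1ℤ)
  import Data.Integer.DivMod as ℤ
  open import Data.Integer.Divisibility.Signed
    using (_∣_; divides; ∣⇒∣ᵤ; ∣ᵤ⇒∣; ∣m∣n⇒∣m+n; ∣m∣n⇒∣m-n; ∣m+n∣m⇒∣n; ∣m⇒∣-m; ∣n⇒∣m*n; ∣m⇒∣m*n)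
  import Data.Integer.Properties as ℤ
  open import Data.Integer.Tactic.RingSolver using (solve-∀)
  open import Data.List using (List; []; _∷_; _++_; replicate; foldr; filter; applyUpTo)
  open import Data.List.Membership.Propositional using (_∈_; _∉_)
  open import Data.List.Membership.Propositional.Properties using (∈-∃++; ∈-filter⁺; ∈-applyUpTo⁺)
  open import Data.List.Relation.Binary.Permutation.Propositional as ↭
    using (_↭_; ↭-refl; ↭-sym; ↭-trans; ↭-prep; ↭-reflexive)
  open import Data.List.Relation.Binary.Permutation.Propositional.Properties
    using (shift; All-resp-↭; filter-↭; map⁺; ↭-empty-inv; ++⁺ˡ)
  open import Data.List.Relation.Binary.Sublist.Propositional using (_⊆_; []; _∷_; _∷ʳ_; minimum)
  open import Data.List.Relation.Binary.Sublist.Propositional.Properties using (++⁺)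
  open import Data.List.Relation.Unary.All as All using (All; []; _∷_)
  import Data.List.Relation.Unary.All.Properties as All
  open import Data.List.Relation.Unary.AllPairs as AllPairs using (AllPairs; []; _∷_)
  import Data.List.Relation.Unary.AllPairs.Properties as AllPairs
  open import Data.List.Relation.Unary.Any as Any using (Any; here; there)
  open import Data.List.Relation.Unary.Unique.Propositional using (Unique)
  open import Data.Nat as ℕ using (ℕ; zero; suc; s≤s; z≤n; NonZero)
  import Data.Nat.Divisibility as ℕ
  import Data.Nat.DivMod as ℕ
  import Data.Nat.ListAction as ℕ using (sum)
  import Data.Nat.ListAction.Properties as ℕ using (sum-↭)
  open import Data.List.Membership.DecPropositional ℕ._≟_ using (_∈?_)
  open import Data.Nat.Primality using (euclidsLemma; prime⇒nonTrivial; ¬prime[0]; ¬prime[1])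
  import Data.Nat.Tactic.RingSolver as ℕ-Solver
  open import Data.Product using (proj₂)
  open import Data.Sum using (_⊎_; inj₁; inj₂; [_,_]′)
  open import Data.Vec as Vec using ([]; _∷_)
  import Data.Vec.Membership.Propositional as V
  import Data.Vec.Relation.Unary.Any as VAny
  open import Function using (_∘_)
  open import Relation.Binary.PropositionalEquality using (refl; cong₂; subst; module ≡-Reasoning)
  open import Relation.Nullary using (¬_; ¬?; yes; no; contradiction)
  open import Relation.Nullary.Decidable using (decidable-stable)

  -- Linear functionals

  -- Functions are compared pointwise throughout; `resp` takes the place of function extensionality,
  -- so that a functional may be rewritten under its argument.
  record Linear {X : Set} (Φ : (X → ℤ) → ℤ) : Set where
    field
      resp    : ∀ {f g} → (∀ x → f x ≡ g x) → Φ f ≡ Φ g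
      combine : ∀ c e f g → Φ (λ x → c * f x + e * g x) ≡ c * Φ f + e * Φ g

    vanish : ∀ c e {f g h} → (∀ x → h x ≡ c * f x + e * g x) →
             Φ f ≡ 0ℤ → Φ g ≡ 0ℤ → Φ h ≡ 0ℤ
    vanish c e {f} {g} {h} h≗ f0 g0 = begin
      Φ h                           ≡⟨ resp h≗ ⟩
      Φ (λ x → c * f x + e * g x)   ≡⟨ combine c e f g ⟩
      c * Φ f + e * Φ g             ≡⟨ cong₂ (λ u v → c * u + e * v) f0 g0 ⟩
      c * 0ℤ + e * 0ℤ               ≡⟨ cong₂ _+_ (ℤ.*-zeroʳ c) (ℤ.*-zeroʳ e) ⟩
      0ℤ                            ∎
      where open ≡-Reasoning

    zero-on : ∀ {f} → (∀ x → f x ≡ 0ℤ) → Φ f ≡ 0ℤ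
    zero-on {f} f0 = begin
      Φ f                            ≡⟨ resp (λ x → trans (f0 x) (sym (lemma (f x)))) ⟩
      Φ (λ x → 0ℤ * f x + 0ℤ * f x)  ≡⟨ combine 0ℤ 0ℤ f f ⟩
      0ℤ * Φ f + 0ℤ * Φ f            ≡⟨ lemma (Φ f) ⟩
      0ℤ                             ∎
      where
      open ≡-Reasoning
      lemma : ∀ u → 0ℤ * u + 0ℤ * u ≡ 0ℤ
      lemma u = cong₂ _+_ (ℤ.*-zeroˡ u) (ℤ.*-zeroˡ u)

  open Linear

  private
    variable
      A X Y : Set

  at-linear : (x : X) → Linear (λ f → f x)
  at-linear x .resp f≗g = f≗g x
  at-linear x .combine c e f g = refl

  scale-linear : ∀ s {Φ : (X → ℤ) → ℤ} → Linear Φ → Linear (λ f → s * Φ f)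
  scale-linear s Φ-lin .resp f≗g = cong (s *_) (resp Φ-lin f≗g)
  scale-linear s {Φ} Φ-lin .combine c e f g =
    trans (cong (s *_) (combine Φ-lin c e f g)) (lemma s c e (Φ f) (Φ g))
    where
    lemma : ∀ s c e u v → s * (c * u + e * v) ≡ c * (s * u) + e * (s * v)
    lemma = solve-∀

  diff-linear : {Φ Ψ : (X → ℤ) → ℤ} → Linear Φ → Linear Ψ → Linear (λ f → Φ f - Ψ f)
  diff-linear Φ-lin Ψ-lin .resp f≗g = cong₂ _-_ (resp Φ-lin f≗g) (resp Ψ-lin f≗g)
  diff-linear {Φ = Φ} {Ψ} Φ-lin Ψ-lin .combine c e f g =
    trans (cong₂ _-_ (combine Φ-lin c e f g) (combine Ψ-lin c e f g))
          (lemma c e (Φ f) (Φ g) (Ψ f) (Ψ g))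
    where
    lemma : ∀ c e u v w z → (c * u + e * v) - (c * w + e * z) ≡ c * (u - w) + e * (v - z)
    lemma = solve-∀

  ∘-linear : {Φ : (X → ℤ) → ℤ} {Λ : X → (Y → ℤ) → ℤ} → Linear Φ → (∀ x → Linear (Λ x)) →
             Linear (λ f → Φ (λ x → Λ x f))
  ∘-linear Φ-lin Λ-lin .resp f≗g = resp Φ-lin (λ x → resp (Λ-lin x) f≗g)
  ∘-linear {Λ = Λ} Φ-lin Λ-lin .combine c e f g =
    trans (resp Φ-lin (λ x → combine (Λ-lin x) c e f g))
          (combine Φ-lin c e (λ x → Λ x f) (λ x → Λ x g))

  -- Signed sums over all choices of signs

  Σ± : List ℤ → (List ℤ → ℤ) → ℤ
  Σ± []       g = g []
  Σ± (a ∷ as) g = Σ± as (λ xs → g (a ∷ xs)) - Σ± as (λ xs → g (- a ∷ xs))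

  Σ±-linear : ∀ as → Linear (Σ± as)
  Σ±-linear []       = at-linear []
  Σ±-linear (a ∷ as) =
    diff-linear (∘-linear (Σ±-linear as) (λ xs → at-linear (a ∷ xs)))
                (∘-linear (Σ±-linear as) (λ xs → at-linear (- a ∷ xs)))

  total : List ℤ → ℤ
  total = foldr _+_ 0ℤ

  -- Alternants

  -- Laplace expansion along a row r; h stands for the complementary minor.
  lap : (ℤ → ℤ) → (List ℤ → ℤ) → List ℤ → ℤ
  lap r h []       = 0ℤ
  lap r h (x ∷ xs) = r x * h xs - lap r (λ ys → h (x ∷ ys)) xs

  lap-linear : ∀ r xs → Linear (λ h → lap r h xs)
  lap-linear r [] .resp _ = refl
  lap-linear r [] .combine c e _ _ = sym (cong₂ _+_ (ℤ.*-zeroʳ c) (ℤ.*-zeroʳ e))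
  lap-linear r (x ∷ xs) =
    diff-linear (scale-linear (r x) (at-linear xs))
                (∘-linear (lap-linear r xs) (λ ys → at-linear (x ∷ ys)))

  lap-linearʳ : ∀ h xs → Linear (λ r → lap r h xs)
  lap-linearʳ h [] .resp _ = refl
  lap-linearʳ h [] .combine c e _ _ = sym (cong₂ _+_ (ℤ.*-zeroʳ c) (ℤ.*-zeroʳ e))
  lap-linearʳ h (x ∷ xs) =
    diff-linear (at-times (h xs)) (lap-linearʳ (λ ys → h (x ∷ ys)) xs)
    where
    at-times : ∀ u → Linear (λ r → r x * u)
    at-times u .resp r≗s = cong (_* u) (r≗s x)
    at-times u .combine c e r s = lemma c e (r x) (s x) u
      where
      lemma : ∀ c e v w u → (c * v + e * w) * u ≡ c * (v * u) + e * (w * u)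
      lemma = solve-∀

  -- Antisymmetry in two rows. Splitting off the first column leaves a term where `r` uses it, a
  -- term where `s` uses it, and a remainder where neither does. The swap exchanges the first two
  -- with opposite signs, and induction treats the remainder.
  lap-swap : ∀ r s h xs → lap r (lap s h) xs ≡ - lap s (lap r h) xs
  lap-swap r s h []       = refl
  lap-swap r s h (x ∷ xs) = begin
    r x * S - lap r (λ ys → s x * h ys - lap s h′ ys) xs
      ≡⟨ cong (λ u → r x * S - u) (expand r s) ⟩
    r x * S - (s x * R + -1ℤ * lap r (lap s h′) xs)
      ≡⟨ cong (λ u → r x * S - (s x * R + -1ℤ * u)) (lap-swap r s h′ xs) ⟩
    r x * S - (s x * R + -1ℤ * - lap s (lap r h′) xs)
      ≡⟨ lemma (r x) S (s x) R (lap s (lap r h′) xs) ⟩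
    - (s x * R - (r x * S + -1ℤ * lap s (lap r h′) xs))
      ≡⟨ cong (λ u → - (s x * R - u)) (expand s r) ⟨
    - (s x * R - lap s (λ ys → r x * h ys - lap r h′ ys) xs) ∎
    where
    open ≡-Reasoning
    h′ : List ℤ → ℤ
    h′ ys = h (x ∷ ys)
    R = lap r h xs
    S = lap s h xs
    minus : ∀ u v → u - v ≡ u + -1ℤ * v
    minus = solve-∀
    expand : ∀ r s → lap r (λ ys → s x * h ys - lap s h′ ys) xs ≡
                     s x * lap r h xs + -1ℤ * lap r (lap s h′) xs
    expand r s = trans (resp (lap-linear r xs) (λ ys → minus (s x * h ys) (lap s h′ ys)))
                       (combine (lap-linear r xs) (s x) -1ℤ h (lap s h′))
    lemma : ∀ a S b R T → a * S - (b * R + -1ℤ * - T) ≡ - (b * R - (a * S + -1ℤ * T))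
    lemma = solve-∀

  -- In each term of the expansion, `total xs` is the entry chosen for row `r` plus the total of the
  -- entries left to the minor.
  lap-leibniz : ∀ r h xs → total xs * lap r h xs ≡
                lap (λ x → x * r x) h xs + lap r (λ ys → total ys * h ys) xs
  lap-leibniz r h []       = refl
  lap-leibniz r h (x ∷ xs) = begin
    (x + T) * (r x * h xs - L)
      ≡⟨ lemma₁ x T (r x) (h xs) L ⟩
    (x * r x) * h xs + r x * (T * h xs) - x * L - T * L
      ≡⟨ cong (λ u → (x * r x) * h xs + r x * (T * h xs) - x * L - u) (lap-leibniz r h′ xs) ⟩
    (x * r x) * h xs + r x * (T * h xs) - x * L - (L₁ + L₂)
      ≡⟨ lemma₂ ((x * r x) * h xs) (r x * (T * h xs)) (x * L) L₁ L₂ ⟩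
    ((x * r x) * h xs - L₁) + (r x * (T * h xs) - (x * L + 1ℤ * L₂))
      ≡⟨ cong (λ u → ((x * r x) * h xs - L₁) + (r x * (T * h xs) - u)) expand ⟨
    ((x * r x) * h xs - L₁) + (r x * (T * h xs) - lap r (λ ys → (x + total ys) * h′ ys) xs) ∎
    where
    open ≡-Reasoning
    h′ : List ℤ → ℤ
    h′ ys = h (x ∷ ys)
    T  = total xs
    L  = lap r h′ xs
    L₁ = lap (λ x → x * r x) h′ xs
    L₂ = lap r (λ ys → total ys * h′ ys) xs
    lemma₁ : ∀ x T a b L → (x + T) * (a * b - L) ≡ (x * a) * b + a * (T * b) - x * L - T * L
    lemma₁ = solve-∀
    lemma₂ : ∀ a b c d e → a + b - c - (d + e) ≡ (a - d) + (b - (c + 1ℤ * e))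
    lemma₂ = solve-∀
    dist : ∀ x t u → (x + t) * u ≡ x * u + 1ℤ * (t * u)
    dist = solve-∀
    expand : lap r (λ ys → (x + total ys) * h′ ys) xs ≡ x * L + 1ℤ * L₂
    expand = trans (resp (lap-linear r xs) (λ ys → dist x (total ys) (h′ ys)))
                   (combine (lap-linear r xs) x 1ℤ h′ (λ ys → total ys * h′ ys))

  -- In the terms where row `r` uses the entry x, the minor is free of x and `r` is even, so
  -- flipping the sign of x changes only the sign of the term. These terms cancel in pairs.
  Σ±-lap-even : ∀ as {r} → (∀ x → r (- x) ≡ r x) → ∀ h → Σ± as (lap r h) ≡ 0ℤ
  Σ±-lap-even []       even h = refl
  Σ±-lap-even (a ∷ as) {r} even h = begin
    Σ± as (λ xs → r a * h xs - lap r (λ ys → h (a ∷ ys)) xs)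
      - Σ± as (λ xs → r (- a) * h xs - lap r (λ ys → h (- a ∷ ys)) xs)
        ≡⟨ cong₂ _-_ (half a) (half (- a)) ⟩
    r a * Σ± as h - r (- a) * Σ± as h  ≡⟨ cong (λ u → r a * Σ± as h - u * Σ± as h) (even a) ⟩
    r a * Σ± as h - r a * Σ± as h      ≡⟨ ℤ.+-inverseʳ (r a * Σ± as h) ⟩
    0ℤ ∎
    where
    open ≡-Reasoning
    minus : ∀ u v → u - v ≡ u + -1ℤ * v
    minus = solve-∀
    half : ∀ b → Σ± as (λ xs → r b * h xs - lap r (λ ys → h (b ∷ ys)) xs) ≡ r b * Σ± as h
    half b = begin
      Σ± as (λ xs → r b * h xs - lap r h′ xs)
        ≡⟨ resp (Σ±-linear as) (λ xs → minus (r b * h xs) (lap r h′ xs)) ⟩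
      Σ± as (λ xs → r b * h xs + -1ℤ * lap r h′ xs)
        ≡⟨ combine (Σ±-linear as) (r b) -1ℤ h (lap r h′) ⟩
      r b * Σ± as h + -1ℤ * Σ± as (lap r h′)
        ≡⟨ cong (λ u → r b * Σ± as h + -1ℤ * u) (Σ±-lap-even as even h′) ⟩
      r b * Σ± as h + 0ℤ
        ≡⟨ ℤ.+-identityʳ (r b * Σ± as h) ⟩
      r b * Σ± as h ∎
      where
      h′ : List ℤ → ℤ
      h′ ys = h (b ∷ ys)

  -- Leftover columns and leftover rows both give 0, so the identities below need no hypothesis that
  -- the matrix is square.
  det : List (ℤ → ℤ) → List ℤ → ℤ
  det []       []      = 1ℤ
  det []       (_ ∷ _) = 0ℤ
  det (r ∷ rs) xs      = lap r (det rs) xs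

  alt : List ℕ → List ℤ → ℤ
  alt ms = det (map (λ m x → x ^ m) ms)

  -- The two outcomes are the two signs of a permutation of the rows. Which one occurs is
  -- immaterial, since only vanishing is at stake.
  alt-↭ : ∀ {ms ns} → ms ↭ ns → (∀ xs → alt ms xs ≡ alt ns xs) ⊎ (∀ xs → alt ms xs ≡ - alt ns xs)
  alt-↭ ↭.refl = inj₁ (λ xs → refl)
  alt-↭ (↭.prep m p) with alt-↭ p
  ... | inj₁ eq = inj₁ (λ xs → resp (lap-linear _ xs) eq)
  ... | inj₂ eq = inj₂ (λ xs → lap-neg (λ x → x ^ m) eq xs)
    where
    neg : ∀ u → - u ≡ -1ℤ * u + 0ℤ * u
    neg = solve-∀
    lap-neg : ∀ r {g h} → (∀ xs → g xs ≡ - h xs) → ∀ xs → lap r g xs ≡ - lap r h xs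
    lap-neg r {g} {h} eq xs = trans
      (resp (lap-linear r xs) (λ ys → trans (eq ys) (neg (h ys))))
      (trans (combine (lap-linear r xs) -1ℤ 0ℤ h h) (sym (neg (lap r h xs))))
  alt-↭ (↭.swap {ys = ns} m n p) with alt-↭ (↭.prep n (↭.prep m p))
  ... | inj₁ eq = inj₂ (λ xs → trans (lap-swap _ _ _ xs) (cong -_ (eq xs)))
  ... | inj₂ eq = inj₁ (λ xs → trans (lap-swap _ _ _ xs)
                          (trans (cong -_ (eq xs)) (ℤ.neg-involutive _)))
  alt-↭ (↭.trans p q) with alt-↭ p | alt-↭ q
  ... | inj₁ eq | inj₁ eq′ = inj₁ (λ xs → trans (eq xs) (eq′ xs))
  ... | inj₁ eq | inj₂ eq′ = inj₂ (λ xs → trans (eq xs) (eq′ xs))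
  ... | inj₂ eq | inj₁ eq′ = inj₂ (λ xs → trans (eq xs) (cong -_ (eq′ xs)))
  ... | inj₂ eq | inj₂ eq′ = inj₁ (λ xs → trans (eq xs)
                               (trans (cong -_ (eq′ xs)) (ℤ.neg-involutive _)))

  -- The two reasons for which a signed sum kills an alternant: an even row, or two equal rows. The
  -- permutation brings the rows in question to the front, where the expansion starts.
  data Degenerate (ms : List ℕ) : Set where
    even-exponent     : ∀ u ns → ms ↭ (u ℕ.+ u) ∷ ns → Degenerate ms
    repeated-exponent : ∀ m ns → ms ↭ m ∷ m ∷ ns → Degenerate ms

  ^-even : ∀ u x → (- x) ^ (u ℕ.+ u) ≡ x ^ (u ℕ.+ u)
  ^-even zero    x = refl
  ^-even (suc u) x rewrite ℕ.+-suc u u =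
    trans (cong (λ z → - x * (- x * z)) (^-even u x)) (lemma x (x ^ (u ℕ.+ u)))
    where
    lemma : ∀ x z → - x * (- x * z) ≡ x * (x * z)
    lemma = solve-∀

  self-neg : ∀ u → u ≡ - u → u ≡ 0ℤ
  self-neg (+ zero)  eq = refl
  self-neg (+ suc n) ()
  self-neg ℤ.-[1+ n ] ()

  Σ±-alt-degenerate : ∀ as {ms} → Degenerate ms → Σ± as (alt ms) ≡ 0ℤ
  Σ±-alt-degenerate as {ms} (even-exponent u ns p) with alt-↭ p
  ... | inj₁ eq = trans (resp (Σ±-linear as) eq) (Σ±-lap-even as (^-even u) (alt ns))
  ... | inj₂ eq = vanish (Σ±-linear as) -1ℤ 0ℤ (λ xs → trans (eq xs) (lemma (alt ((u ℕ.+ u) ∷ ns) xs)))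
                    (Σ±-lap-even as (^-even u) (alt ns)) (Σ±-lap-even as (^-even u) (alt ns))
    where
    lemma : ∀ u → - u ≡ -1ℤ * u + 0ℤ * u
    lemma = solve-∀
  Σ±-alt-degenerate as {ms} (repeated-exponent m ns p) = zero-on (Σ±-linear as) alt≡0
    where
    repeated : ∀ xs → alt (m ∷ m ∷ ns) xs ≡ 0ℤ
    repeated xs = self-neg _ (lap-swap _ _ (alt ns) xs)
    alt≡0 : ∀ xs → alt ms xs ≡ 0ℤ
    alt≡0 xs with alt-↭ p
    ... | inj₁ eq = trans (eq xs) (repeated xs)
    ... | inj₂ eq = trans (eq xs) (cong -_ (repeated xs))

  private
    ∈-↭ : {m : ℕ} {ms : List ℕ} → m ∈ ms → ∃ λ ns → ms ↭ m ∷ ns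
    ∈-↭ m∈ms with ys , zs , refl ← ∈-∃++ m∈ms = ys ++ zs , shift _ ys zs

    shrink : ∀ {b} ms → All (ℕ._< suc b) ms → ¬ (b ∈ ms) → All (ℕ._< b) ms
    shrink ms bounded b∉ms = All.zipWith (λ (m≤b , m≢b) → ℕ.≤∧≢⇒< (ℕ.≤-pred m≤b) (m≢b ∘ sym))
                               (bounded , All.¬Any⇒All¬ ms b∉ms)

  -- Distinct odd numbers have sum at least 1 + 3 + ⋯ + (2d - 1) = d².
  degenerate-or-large : ∀ b ms → All (ℕ._< b ℕ.+ b) ms →
    Degenerate ms ⊎ (length ms ℕ.≤ b × length ms ℕ.* length ms ℕ.≤ ℕ.sum ms)
  degenerate-or-large zero    []      bounded = inj₂ (z≤n , z≤n)
  degenerate-or-large zero    (_ ∷ _) (() ∷ _)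
  -- The two largest candidates 2b + 1 and 2b are examined. An occurrence of 2b, or a second one of
  -- 2b + 1, is degenerate; otherwise the remaining exponents are below 2b.
  degenerate-or-large (suc b) ms bounded rewrite ℕ.+-suc b b with suc (b ℕ.+ b) ∈? ms
  ... | no 2b+1∉ms with (b ℕ.+ b) ∈? ms
  ...   | yes 2b∈ms = inj₁ (even-exponent b _ (proj₂ (∈-↭ 2b∈ms)))
  ...   | no 2b∉ms with degenerate-or-large b ms (shrink ms (shrink ms bounded 2b+1∉ms) 2b∉ms)
  ...     | inj₁ deg = inj₁ deg
  ...     | inj₂ (short , large) = inj₂ (ℕ.m≤n⇒m≤1+n short , large)
  degenerate-or-large (suc b) ms bounded | yes 2b+1∈ms with ∈-↭ 2b+1∈ms
  ... | ns , p with suc (b ℕ.+ b) ∈? ns | All-resp-↭ p bounded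
  ...   | yes again | _ = inj₁ (repeated-exponent _ _ (↭-trans p (↭-prep _ (proj₂ (∈-↭ again)))))
  ...   | no 2b+1∉ns | _ ∷ bounded′ with (b ℕ.+ b) ∈? ns
  ...     | yes 2b∈ns = inj₁ (even-exponent b _ (↭-trans p
                          (↭-trans (↭-prep _ (proj₂ (∈-↭ 2b∈ns))) (↭.swap _ _ ↭-refl))))
  ...     | no 2b∉ns with degenerate-or-large b ns (shrink ns (shrink ns bounded′ 2b+1∉ns) 2b∉ns)
  ...       | inj₁ (even-exponent u ks q) =
                inj₁ (even-exponent u _ (↭-trans p (↭-trans (↭-prep _ q) (↭.swap _ _ ↭-refl))))
  ...       | inj₁ (repeated-exponent m ks q) =
                inj₁ (repeated-exponent m _ (↭-trans p (↭-trans (↭-prep _ q)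
                  (↭-trans (↭.swap _ _ ↭-refl) (↭-prep _ (↭.swap _ _ ↭-refl))))))
  -- The bound d ≤ b on the length is carried along for this step: the new exponent 2b + 1 then pays
  -- for the growth 2d + 1 of the square.
  ...       | inj₂ (short , large) rewrite ↭-length p | ℕ.sum-↭ p = inj₂ (s≤s short , (begin
                suc d ℕ.* suc d                ≡⟨ square d ⟩
                suc (d ℕ.+ d) ℕ.+ d ℕ.* d      ≤⟨ ℕ.+-mono-≤ (s≤s (ℕ.+-mono-≤ short short)) large ⟩
                suc (b ℕ.+ b) ℕ.+ ℕ.sum ns     ∎))
    where
    open ℕ.≤-Reasoning
    d = length ns
    square : ∀ d → suc d ℕ.* suc d ≡ suc (d ℕ.+ d) ℕ.+ d ℕ.* d
    square = ℕ-Solver.solve-∀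

  degenerate : ∀ ms → ℕ.sum ms ℕ.< length ms ℕ.* length ms → Degenerate ms
  degenerate ms small
    -- Every exponent is at most the sum, so this value of `b` is large enough.
    with degenerate-or-large (suc (ℕ.sum ms)) ms
           (All.map (λ m≤s → ℕ.m≤n⇒m≤n+o _ (s≤s m≤s)) (below-sum ms))
    where
    below-sum : ∀ ms → All (ℕ._≤ ℕ.sum ms) ms
    below-sum []       = []
    below-sum (m ∷ ms) = ℕ.m≤m+n m _ ∷ All.map (λ le → ℕ.≤-trans le (ℕ.m≤n+m _ m)) (below-sum ms)
  ... | inj₁ deg         = deg
  ... | inj₂ (_ , large) = contradiction small (ℕ.≤⇒≯ large)

  -- Moments of alternants

  private
    raise : List ℕ → List (List ℕ)
    raise []       = []
    raise (m ∷ ms) = (suc m ∷ ms) ∷ map (m ∷_) (raise ms)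

    Σalt : List (List ℕ) → List ℤ → ℤ
    Σalt []         xs = 0ℤ
    Σalt (ms ∷ mss) xs = alt ms xs + Σalt mss xs

    raise-weight : ∀ ms → All (λ ns → length ns ≡ length ms × ℕ.sum ns ≡ suc (ℕ.sum ms)) (raise ms)
    raise-weight []       = []
    raise-weight (m ∷ ms) = (refl , refl) ∷ All.map⁺ (All.map
      (λ (len , wt) → cong suc len , trans (cong (m ℕ.+_) wt) (ℕ.+-suc m _)) (raise-weight ms))

    Σalt-map-∷ : ∀ m mss xs → Σalt (map (m ∷_) mss) xs ≡ lap (_^ m) (Σalt mss) xs
    Σalt-map-∷ m []         xs = sym (zero-on (lap-linear (_^ m) xs) (λ _ → refl))
    Σalt-map-∷ m (ms ∷ mss) xs = begin
      alt (m ∷ ms) xs + Σalt (map (m ∷_) mss) xs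
        ≡⟨ cong (λ u → alt (m ∷ ms) xs + u) (Σalt-map-∷ m mss xs) ⟩
      lap (_^ m) (alt ms) xs + lap (_^ m) (Σalt mss) xs
        ≡⟨ one (alt (m ∷ ms) xs) (lap (_^ m) (Σalt mss) xs) ⟩
      1ℤ * lap (_^ m) (alt ms) xs + 1ℤ * lap (_^ m) (Σalt mss) xs
        ≡⟨ combine (lap-linear (_^ m) xs) 1ℤ 1ℤ (alt ms) (Σalt mss) ⟨
      lap (_^ m) (λ ys → 1ℤ * alt ms ys + 1ℤ * Σalt mss ys) xs
        ≡⟨ resp (lap-linear (_^ m) xs) (λ ys → one (alt ms ys) (Σalt mss ys)) ⟨
      lap (_^ m) (λ ys → alt ms ys + Σalt mss ys) xs ∎
      where
      open ≡-Reasoning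
      one : ∀ u v → u + v ≡ 1ℤ * u + 1ℤ * v
      one = solve-∀

  -- Iterates `lap-leibniz` over the rows: multiplying by the sum of the variables raises one
  -- exponent at a time, each row in turn.
  alt-leibniz : ∀ ms xs → total xs * alt ms xs ≡ Σalt (raise ms) xs
  alt-leibniz []       []       = refl
  alt-leibniz []       (x ∷ xs) = ℤ.*-zeroʳ (total (x ∷ xs))
  alt-leibniz (m ∷ ms) xs       = begin
    total xs * lap (_^ m) (alt ms) xs
      ≡⟨ lap-leibniz (_^ m) (alt ms) xs ⟩
    alt (suc m ∷ ms) xs + lap (_^ m) (λ ys → total ys * alt ms ys) xs
      ≡⟨ cong (λ u → alt (suc m ∷ ms) xs + u) (resp (lap-linear (_^ m) xs) (alt-leibniz ms)) ⟩
    alt (suc m ∷ ms) xs + lap (_^ m) (Σalt (raise ms)) xs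
      ≡⟨ cong (λ u → alt (suc m ∷ ms) xs + u) (Σalt-map-∷ m (raise ms) xs) ⟨
    alt (suc m ∷ ms) xs + Σalt (map (m ∷_) (raise ms)) xs ∎
    where open ≡-Reasoning

  -- Each factor `total xs` is absorbed by `alt-leibniz`, which keeps the number of exponents and
  -- adds 1 to their sum. After `k` factors the sum is still below the square of the length, so
  -- every alternant reached is degenerate.
  alt-moment : ∀ as k ms → ℕ.sum ms ℕ.+ k ℕ.< length ms ℕ.* length ms →
               Σ± as (λ xs → total xs ^ k * alt ms xs) ≡ 0ℤ
  alt-moment as zero ms small =
    trans (resp (Σ±-linear as) (λ xs → ℤ.*-identityˡ (alt ms xs)))
          (Σ±-alt-degenerate as (degenerate ms (ℕ.≤-<-trans (ℕ.≤-reflexive (sym (ℕ.+-identityʳ _))) small)))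
  alt-moment as (suc k) ms small =
    trans (resp (Σ±-linear as) pointwise) (sum-vanishes (raise ms) (All.map (λ {ns} → raised {ns}) (raise-weight ms)))
    where
    rearrange : ∀ s z u → (s * z) * u ≡ z * (s * u)
    rearrange = solve-∀
    pointwise : ∀ xs → total xs ^ suc k * alt ms xs ≡ total xs ^ k * Σalt (raise ms) xs
    pointwise xs = trans (rearrange (total xs) (total xs ^ k) (alt ms xs))
                         (cong (total xs ^ k *_) (alt-leibniz ms xs))
    raised : ∀ {ns} → length ns ≡ length ms × ℕ.sum ns ≡ suc (ℕ.sum ms) →
             Σ± as (λ xs → total xs ^ k * alt ns xs) ≡ 0ℤ
    raised {ns} (len , wt) = alt-moment as k ns (begin-strict
      ℕ.sum ns ℕ.+ k            ≡⟨ cong (ℕ._+ k) wt ⟩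
      suc (ℕ.sum ms) ℕ.+ k      ≡⟨ ℕ.+-suc (ℕ.sum ms) k ⟨
      ℕ.sum ms ℕ.+ suc k        <⟨ small ⟩
      length ms ℕ.* length ms   ≡⟨ cong (λ d → d ℕ.* d) len ⟨
      length ns ℕ.* length ns   ∎)
      where open ℕ.≤-Reasoning
    distrib : ∀ z u v → z * (u + v) ≡ 1ℤ * (z * u) + 1ℤ * (z * v)
    distrib = solve-∀
    sum-vanishes : ∀ mss → All (λ ns → Σ± as (λ xs → total xs ^ k * alt ns xs) ≡ 0ℤ) mss →
                   Σ± as (λ xs → total xs ^ k * Σalt mss xs) ≡ 0ℤ
    sum-vanishes []         []       = zero-on (Σ±-linear as) (λ xs → ℤ.*-zeroʳ (total xs ^ k))
    sum-vanishes (ns ∷ mss) (z ∷ zs) = vanish (Σ±-linear as) 1ℤ 1ℤ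
      (λ xs → distrib (total xs ^ k) (alt ns xs) (Σalt mss xs)) z (sum-vanishes mss zs)

  -- Polynomial rows and the weights of blocks

  -- The monic polynomial with roots -c. The sign suits evaluation at the all-minus choice.
  ρ : List ℤ → ℤ → ℤ
  ρ []       x = 1ℤ
  ρ (c ∷ cs) x = (c + x) * ρ cs x

  ρ-replicate-0 : ∀ j x → ρ (replicate j 0ℤ) x ≡ x ^ j
  ρ-replicate-0 zero    x = refl
  ρ-replicate-0 (suc j) x = cong₂ _*_ (ℤ.+-identityˡ x) (ρ-replicate-0 j x)

  degrees : List (List ℤ) → ℕ
  degrees = ℕ.sum ∘ map length

  -- Multilinearity in the rows expands the determinant into alternants whose exponents are bounded,
  -- row by row, by the degrees. Once a row is a monomial, the expansion along it is absorbed into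
  -- the functional.
  linear-det-vanish : ∀ {Φ} → Linear Φ → ∀ css →
    (∀ ms → length ms ≡ length css → ℕ.sum ms ℕ.≤ degrees css → Φ (alt ms) ≡ 0ℤ) →
    Φ (det (map ρ css)) ≡ 0ℤ
  linear-det-vanish Φ-lin []         alt0 = alt0 [] refl z≤n
  linear-det-vanish {Φ} Φ-lin (cs ∷ css) alt0 = trans
    (resp Φ-lin (λ xs → resp (lap-linearʳ (det (map ρ css)) xs) (λ x → sym (ℤ.*-identityˡ (ρ cs x)))))
    (expand cs 0 ℕ.≤-refl)
    where
    monomial : ∀ i → i ℕ.≤ length cs → Φ (lap (_^ i) (det (map ρ css))) ≡ 0ℤ
    monomial i i≤ = linear-det-vanish (∘-linear Φ-lin (lap-linear (_^ i))) css
      (λ ms len wt → alt0 (i ∷ ms) (cong suc len) (ℕ.+-mono-≤ i≤ wt))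
    step : ∀ z c x u → z * ((c + x) * u) ≡ c * (z * u) + 1ℤ * ((x * z) * u)
    step = solve-∀
    -- The row is multiplied out one factor c + x at a time: `x ^ i` collects the chosen x, and
    -- `cs′` holds the factors still to be expanded.
    expand : ∀ cs′ i → i ℕ.+ length cs′ ℕ.≤ length cs →
             Φ (lap (λ x → x ^ i * ρ cs′ x) (det (map ρ css))) ≡ 0ℤ
    expand []       i le = trans
      (resp Φ-lin (λ xs → resp (lap-linearʳ (det (map ρ css)) xs) (λ x → ℤ.*-identityʳ (x ^ i))))
      (monomial i (ℕ.≤-trans (ℕ.≤-reflexive (sym (ℕ.+-identityʳ i))) le))
    expand (c ∷ cs′) i le = vanish Φ-lin c 1ℤ
      (λ xs → trans
        (resp (lap-linearʳ (det (map ρ css)) xs) (λ x → step (x ^ i) c x (ρ cs′ x)))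
        (combine (lap-linearʳ (det (map ρ css)) xs) c 1ℤ (λ x → x ^ i * ρ cs′ x) (λ x → x ^ suc i * ρ cs′ x)))
      (expand cs′ i (ℕ.≤-trans (ℕ.+-monoʳ-≤ i (ℕ.n≤1+n _)) le))
      (expand cs′ (suc i) (ℕ.≤-trans (ℕ.≤-reflexive (sym (ℕ.+-suc i _))) le))

  triangle : ℕ → ℕ
  triangle zero    = zero
  triangle (suc d) = suc d ℕ.+ triangle d

  -- The rows of the alternant of a block form a Newton basis, so that the
  -- alternant is triangular at the point map -_ as.
  newton : List ℤ → List ℤ → List (List ℤ)
  newton cs []       = []
  newton cs (a ∷ as) = cs ∷ newton (a ∷ cs) as

  length-newton : ∀ cs as → length (newton cs as) ≡ length as
  length-newton cs []       = refl
  length-newton cs (a ∷ as) = cong suc (length-newton (a ∷ cs) as)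

  -- The rows have degrees l, ..., l + d - 1, where l and d are the lengths of `cs` and `as`. The
  -- triangular number stands on the left to avoid truncated subtraction.
  degrees-newton : ∀ cs as → degrees (newton cs as) ℕ.+ triangle (length as) ≡
                             length as ℕ.* length as ℕ.+ length cs ℕ.* length as
  degrees-newton cs []       = sym (ℕ.*-zeroʳ (length cs))
  degrees-newton cs (a ∷ as) = begin
    l ℕ.+ D ℕ.+ (suc d ℕ.+ T)               ≡⟨ lemma₁ l D d T ⟩
    l ℕ.+ suc d ℕ.+ (D ℕ.+ T)               ≡⟨ cong (l ℕ.+ suc d ℕ.+_) (degrees-newton (a ∷ cs) as) ⟩
    l ℕ.+ suc d ℕ.+ (d ℕ.* d ℕ.+ suc l ℕ.* d) ≡⟨ lemma₂ l d ⟩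
    suc d ℕ.* suc d ℕ.+ l ℕ.* suc d         ∎
    where
    open ≡-Reasoning
    l = length cs
    d = length as
    D = degrees (newton (a ∷ cs) as)
    T = triangle d
    lemma₁ : ∀ l D d T → l ℕ.+ D ℕ.+ (suc d ℕ.+ T) ≡ l ℕ.+ suc d ℕ.+ (D ℕ.+ T)
    lemma₁ = ℕ-Solver.solve-∀
    lemma₂ : ∀ l d → l ℕ.+ suc d ℕ.+ (d ℕ.* d ℕ.+ suc l ℕ.* d) ≡ suc d ℕ.* suc d ℕ.+ l ℕ.* suc d
    lemma₂ = ℕ-Solver.solve-∀

  -- The rows are monic of degrees 0, ..., d - 1, so for `xs` of the length d of `as` this is the
  -- Vandermonde determinant of `xs`.
  weight : List ℤ → List ℤ → ℤ
  weight as = det (map ρ (newton [] as))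

  -- The alternants in the weight have exponent sum at most d(d-1)/2, and d(d-1)/2 + d(d+1)/2 = d²
  -- is the threshold of `alt-moment`.
  block-moment : ∀ as k → k ℕ.< triangle (length as) →
                 Σ± as (λ xs → total xs ^ k * weight as xs) ≡ 0ℤ
  block-moment as k small =
    linear-det-vanish (∘-linear (Σ±-linear as) (λ xs → scale-linear (total xs ^ k) (at-linear xs)))
      (newton [] as)
      (λ ms len wt → alt-moment as k ms (begin-strict
        ℕ.sum ms ℕ.+ k                                   <⟨ ℕ.+-mono-≤-< wt small ⟩
        degrees (newton [] as) ℕ.+ triangle (length as)  ≡⟨ degrees-newton [] as ⟩
        length as ℕ.* length as ℕ.+ 0                    ≡⟨ ℕ.+-identityʳ _ ⟩
        length as ℕ.* length as
          ≡⟨ cong (λ d → d ℕ.* d) (trans len (length-newton [] as)) ⟨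
        length ms ℕ.* length ms                          ∎))
    where open ℕ.≤-Reasoning

  -- The value ∑ w(x) f(∑ x) over all signed versions x of all the blocks, w being the
  -- product of the signs and of the weights of the blocks.
  blockSum : List (List ℤ) → (ℤ → ℤ) → ℤ
  blockSum []         f = f 0ℤ
  blockSum (as ∷ bss) f = Σ± as (λ xs → weight as xs * blockSum bss (λ y → f (total xs + y)))

  blockSum-linear : ∀ bss → Linear (blockSum bss)
  blockSum-linear []         = at-linear 0ℤ
  blockSum-linear (as ∷ bss) = ∘-linear (Σ±-linear as) (λ xs → scale-linear (weight as xs)
    (∘-linear (blockSum-linear bss) (λ y → at-linear (total xs + y))))

  order : List (List ℤ) → ℕ
  order []         = 0
  order (as ∷ bss) = triangle (length as) ℕ.+ order bss

  -- With s the total of the first block and y that of the others, the product expands into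
  -- monomials s^i y^j with i + j below the order. Either j is below the order of the other blocks
  -- and the inner sum vanishes by induction, or i is small enough for `block-moment`.
  blockSum-ρ : ∀ bss cs → length cs ℕ.< order bss → blockSum bss (ρ cs) ≡ 0ℤ
  blockSum-ρ []         cs ()
  blockSum-ρ (as ∷ bss) cs small = trans
    (resp (Σ±-linear as) (λ xs → trans
      (cong (weight as xs *_) (resp (blockSum-linear bss) (λ y → sym (ℤ.*-identityˡ (ρ cs (total xs + y))))))
      (sym (ℤ.*-identityˡ _))))
    (mixed cs 0 0 small)
    where
    B : (ℤ → ℤ) → ℤ
    B = blockSum bss
    term : ℕ → ℕ → List ℤ → List ℤ → ℤ
    term i j cs xs = total xs ^ i * (weight as xs * B (λ y → y ^ j * ρ cs (total xs + y)))
    mixed : ∀ cs i j → i ℕ.+ j ℕ.+ length cs ℕ.< triangle (length as) ℕ.+ order bss →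
            Σ± as (term i j cs) ≡ 0ℤ
    mixed [] i j lt with j ℕ.<? order bss
    ... | yes j< = zero-on (Σ±-linear as) (λ xs →
            trans (cong (λ u → total xs ^ i * (weight as xs * u)) moment)
                  (annihilate (total xs ^ i) (weight as xs)))
      where
      annihilate : ∀ u v → u * (v * 0ℤ) ≡ 0ℤ
      annihilate = solve-∀
      moment : B (λ y → y ^ j * 1ℤ) ≡ 0ℤ
      moment = trans
        (resp (blockSum-linear bss) (λ y → trans (ℤ.*-identityʳ (y ^ j)) (sym (ρ-replicate-0 j y))))
        -- The induction hypothesis speaks of products `ρ`, so y^j is presented as the product with
        -- a `j`-fold root at 0.
        (blockSum-ρ bss (replicate j 0ℤ) (ℕ.≤-<-trans (ℕ.≤-reflexive (List.length-replicate j)) j<))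
    ... | no j≮ = vanish (Σ±-linear as) K 0ℤ (λ xs → pull (total xs ^ i) (weight as xs) K)
                    (block-moment as i i<) (block-moment as i i<)
      where
      K : ℤ
      K = B (λ y → y ^ j * 1ℤ)
      pull : ∀ z w K → z * (w * K) ≡ K * (z * w) + 0ℤ * (z * w)
      pull = solve-∀
      i< : i ℕ.< triangle (length as)
      i< = ℕ.+-cancelʳ-< _ _ _ (ℕ.≤-<-trans (ℕ.+-monoʳ-≤ i (ℕ.≮⇒≥ j≮))
             (ℕ.≤-<-trans (ℕ.≤-reflexive (sym (ℕ.+-identityʳ (i ℕ.+ j)))) lt))
    mixed (c ∷ cs) i j lt = vanish (Σ±-linear as) 1ℤ 1ℤ split
      (vanish (Σ±-linear as) c 1ℤ (λ xs → refl)
        (mixed cs i j (ℕ.≤-<-trans (ℕ.+-monoʳ-≤ (i ℕ.+ j) (ℕ.n≤1+n _)) lt))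
        (mixed cs (suc i) j lt′))
      (mixed cs i (suc j) (ℕ.≤-<-trans (ℕ.≤-reflexive (cong (ℕ._+ length cs) (ℕ.+-suc i j))) lt′))
      where
      lt′ : suc (i ℕ.+ j) ℕ.+ length cs ℕ.< triangle (length as) ℕ.+ order bss
      lt′ = ℕ.≤-<-trans (ℕ.≤-reflexive (sym (ℕ.+-suc (i ℕ.+ j) (length cs)))) lt
      inner : ∀ z c s y u → z * ((c + (s + y)) * u) ≡ (c + s) * (z * u) + 1ℤ * ((y * z) * u)
      inner = solve-∀
      outer : ∀ z w c s u v → z * (w * ((c + s) * u + 1ℤ * v)) ≡
              1ℤ * (c * (z * (w * u)) + 1ℤ * ((s * z) * (w * u))) + 1ℤ * (z * (w * v))
      outer = solve-∀
      split : ∀ xs → term i j (c ∷ cs) xs ≡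
              1ℤ * (c * term i j cs xs + 1ℤ * term (suc i) j cs xs) + 1ℤ * term i (suc j) cs xs
      split xs = trans
        (cong (λ u → total xs ^ i * (weight as xs * u))
          (trans (resp (blockSum-linear bss) (λ y → inner (y ^ j) c (total xs) y (ρ cs (total xs + y))))
                 (combine (blockSum-linear bss) (c + total xs) 1ℤ
                   (λ y → y ^ j * ρ cs (total xs + y)) (λ y → y ^ suc j * ρ cs (total xs + y)))))
        (outer (total xs ^ i) (weight as xs) c (total xs)
          (B (λ y → y ^ j * ρ cs (total xs + y))) (B (λ y → y ^ suc j * ρ cs (total xs + y))))

  -- Signed sums modulo p

  prime-∣-* : ∀ {p} → Prime p → ∀ x y → + p ∣ x * y → + p ∣ x ⊎ + p ∣ y
  prime-∣-* {p} pp x y p∣xy =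
    [ inj₁ ∘ ∣ᵤ⇒∣ , inj₂ ∘ ∣ᵤ⇒∣ ]′
      (euclidsLemma ℤ.∣ x ∣ ℤ.∣ y ∣ pp (subst (p ℕ.∣_) (ℤ.abs-* x y) (∣⇒∣ᵤ p∣xy)))

  total-++ : ∀ xs ys → total (xs ++ ys) ≡ total xs + total ys
  total-++ []       ys = sym (ℤ.+-identityˡ (total ys))
  total-++ (x ∷ xs) ys = trans (cong (λ u → x + u) (total-++ xs ys)) (sym (ℤ.+-assoc x (total xs) (total ys)))

  total-neg : ∀ as → total (map -_ as) ≡ - total as
  total-neg []       = refl
  total-neg (a ∷ as) = trans (cong (λ u → - a + u) (total-neg as)) (sym (ℤ.neg-distrib-+ a (total as)))

  -- z is the signed sum of as in which exactly the terms in I get the sign +.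
  record SignedSum (as I : List ℤ) (z : ℤ) : Set where
    constructor signed
    field doubled : z + total as ≡ total I + total I

  SignedSum-pos : ∀ a {as I z} → SignedSum as I z → SignedSum (a ∷ as) (a ∷ I) (a + z)
  SignedSum-pos a {as} {I} {z} (signed eq) = signed
    (trans (lemma₁ a z (total as)) (trans (cong (λ u → a + a + u) eq) (lemma₂ a (total I))))
    where
    lemma₁ : ∀ a z s → (a + z) + (a + s) ≡ a + a + (z + s)
    lemma₁ = solve-∀
    lemma₂ : ∀ a t → a + a + (t + t) ≡ (a + t) + (a + t)
    lemma₂ = solve-∀

  SignedSum-neg : ∀ a {as I z} → SignedSum as I z → SignedSum (a ∷ as) I (- a + z)
  SignedSum-neg a {as} {z = z} (signed eq) = signed (trans (lemma a z (total as)) eq)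
    where
    lemma : ∀ a z s → (- a + z) + (a + s) ≡ z + s
    lemma = solve-∀

  Σ±-∣ : ∀ {d} as {g} → (∀ {I} → I ⊆ as → ∀ xs → SignedSum as I (total xs) → d ∣ g xs) → d ∣ Σ± as g
  Σ±-∣ []       d∣g = d∣g [] [] (signed refl)
  Σ±-∣ (a ∷ as) d∣g = ∣m∣n⇒∣m-n
    (Σ±-∣ as (λ I⊆ xs eq → d∣g (refl ∷ I⊆) (a ∷ xs) (SignedSum-pos a eq)))
    (Σ±-∣ as (λ I⊆ xs eq → d∣g (a ∷ʳ I⊆) (- a ∷ xs) (SignedSum-neg a eq)))

  -- Every term with a plus sign is divisible by `d`, so the one remaining term must be so as well.
  -- The plus half is discarded one entry at a time.
  Σ±-∣-last : ∀ {d} as {g} →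
    (∀ {I} → I ⊆ as → I ≢ [] → ∀ xs → SignedSum as I (total xs) → d ∣ g xs) →
    d ∣ Σ± as g → d ∣ g (map -_ as)
  Σ±-∣-last []       d∣g d∣Σ = d∣Σ
  Σ±-∣-last {d} (a ∷ as) {g} d∣g d∣Σ = Σ±-∣-last as
    (λ I⊆ I≢[] xs eq → d∣g (a ∷ʳ I⊆) I≢[] (- a ∷ xs) (SignedSum-neg a eq))
    (subst (d ∣_) (ℤ.neg-involutive _) (∣m⇒∣-m
      (∣m+n∣m⇒∣n d∣Σ (Σ±-∣ as (λ I⊆ xs eq →
        d∣g (refl ∷ I⊆) (λ ()) (a ∷ xs) (SignedSum-pos a eq))))))

  SignedSum-++ : ∀ {as bs I J x y} → SignedSum as I x → SignedSum bs J y →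
                 SignedSum (as ++ bs) (I ++ J) (x + y)
  SignedSum-++ {as} {bs} {I} {J} {x} {y} (signed eq₁) (signed eq₂) = signed (begin
    x + y + total (as ++ bs)                     ≡⟨ cong (λ u → x + y + u) (total-++ as bs) ⟩
    x + y + (total as + total bs)                ≡⟨ interchange x y (total as) (total bs) ⟩
    (x + total as) + (y + total bs)              ≡⟨ cong₂ _+_ eq₁ eq₂ ⟩
    (total I + total I) + (total J + total J)    ≡⟨ interchange (total I) (total I) (total J) (total J) ⟩
    (total I + total J) + (total I + total J)    ≡⟨ cong (λ t → t + t) (total-++ I J) ⟨
    total (I ++ J) + total (I ++ J)              ∎)
    where
    open ≡-Reasoning
    interchange : ∀ a b c d → (a + b) + (c + d) ≡ (a + c) + (b + d)
    interchange = solve-∀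

  blockSum-∣ : ∀ {d} bss {f} → (∀ {I} → I ⊆ concat bss → ∀ z → SignedSum (concat bss) I z → d ∣ f z) →
               d ∣ blockSum bss f
  blockSum-∣ []         d∣f = d∣f [] 0ℤ (signed refl)
  blockSum-∣ (as ∷ bss) d∣f = Σ±-∣ as (λ I⊆ xs eq → ∣n⇒∣m*n (weight as xs)
    (blockSum-∣ bss (λ J⊆ z eq′ → d∣f (++⁺ I⊆ J⊆) (total xs + z)
      (SignedSum-++ eq eq′))))

  -- If p divided the sum, `Σ±-∣-last` on the first block would leave its all-minus term: the weight
  -- there times the sum over the other blocks with `f` translated. Primality removes the weight,
  -- and induction applies.
  blockSum-∤ : ∀ {p} → Prime p → ∀ bss {f} →
    All (λ as → ¬ (+ p ∣ weight as (map -_ as))) bss →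
    (∀ {I} → I ⊆ concat bss → I ≢ [] → ∀ z → SignedSum (concat bss) I z → + p ∣ f z) →
    ¬ (+ p ∣ f (- total (concat bss))) →
    ¬ (+ p ∣ blockSum bss f)
  blockSum-∤ pp [] [] p∣f p∤f = p∤f
  blockSum-∤ {p} pp (as ∷ bss) {f} (p∤w ∷ p∤ws) p∣f p∤f p∣Σ =
    [ p∤w , blockSum-∤ pp bss p∤ws
        (λ J⊆ J≢[] z eq → p∣f (++⁺ (minimum as) J⊆) J≢[] (total (map -_ as) + z)
           (SignedSum-++ all-minus eq))
        (p∤f ∘ subst (λ z → + p ∣ f z) combined) ]′
    (prime-∣-* pp (weight as (map -_ as)) _ (Σ±-∣-last as
      (λ {I} I⊆ I≢[] xs eq → ∣n⇒∣m*n (weight as xs)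
        (blockSum-∣ bss (λ {J} J⊆ z eq′ → p∣f (++⁺ I⊆ J⊆) (I≢[] ∘ List.++-conicalˡ I J) (total xs + z)
          (SignedSum-++ eq eq′))))
      p∣Σ))
    where
    all-minus : SignedSum as [] (total (map -_ as))
    all-minus = signed (trans (cong (_+ total as) (total-neg as)) (ℤ.+-inverseˡ (total as)))
    combined : total (map -_ as) + - total (concat bss) ≡ - total (as ++ concat bss)
    combined = trans (cong (_+ - total (concat bss)) (total-neg as))
      (trans (sym (ℤ.neg-distrib-+ (total as) (total (concat bss))))
             (cong -_ (sym (total-++ as (concat bss)))))

  -- Nonvanishing of the weights

  det-zero-column : ∀ rs x ys → All (λ r → r x ≡ 0ℤ) rs → det rs (x ∷ ys) ≡ 0ℤ
  det-zero-column []       x ys []        = refl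
  det-zero-column (r ∷ rs) x ys (r0 ∷ r0s) = cong₂ _-_
    (trans (cong (_* det rs ys) r0) (ℤ.*-zeroˡ (det rs ys)))
    (Linear.zero-on (lap-linear r ys) (λ zs → det-zero-column rs x zs r0s))

  ρ-root : ∀ {a cs} → a ∈ cs → ρ cs (- a) ≡ 0ℤ
  ρ-root {a} {c ∷ cs} (here refl)  = trans (cong (_* ρ cs (- a)) (ℤ.+-inverseʳ a)) (ℤ.*-zeroˡ (ρ cs (- a)))
  ρ-root {a} {c ∷ cs} (there a∈cs) = trans (cong ((c + - a) *_) (ρ-root a∈cs)) (ℤ.*-zeroʳ (c + - a))

  newton-roots : ∀ {a cs} as → a ∈ cs → All (λ r → r (- a) ≡ 0ℤ) (map ρ (newton cs as))
  newton-roots []       a∈cs = []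
  newton-roots (b ∷ as) a∈cs = ρ-root a∈cs ∷ newton-roots as (there a∈cs)

  ρ-∤ : ∀ {p} → Prime p → ∀ {x} cs → All (λ c → ¬ (+ p ∣ c + x)) cs → ¬ (+ p ∣ ρ cs x)
  ρ-∤ {p} pp {x} [] [] p∣1 = contradiction (ℕ.∣1⇒≡1 (∣⇒∣ᵤ p∣1)) (ℕ.nonTrivial⇒≢1 {{prime⇒nonTrivial pp}})
  ρ-∤ pp {x} (c ∷ cs) (p∤c ∷ p∤cs) p∣ = [ p∤c , ρ-∤ pp cs p∤cs ]′ (prime-∣-* pp (c + x) (ρ cs x) p∣)

  -- At the all-minus point, every row after the first has the root -a, so the first column has only
  -- its top entry and the determinant is a product of differences c - a. The list `cs` holds the
  -- entries already passed.
  newton-∤ : ∀ {p} → Prime p → ∀ cs as →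
    All (λ a → All (λ c → ¬ (+ p ∣ c - a)) cs) as → AllPairs (λ c a → ¬ (+ p ∣ c - a)) as →
    ¬ (+ p ∣ det (map ρ (newton cs as)) (map -_ as))
  newton-∤ pp cs [] _ _ p∣ = ρ-∤ pp {0ℤ} [] [] p∣
  newton-∤ {p} pp cs (a ∷ as) (p∤a ∷ p∤as) (distinct ∷ distincts) p∣ =
    [ ρ-∤ pp cs p∤a
    , newton-∤ pp (a ∷ cs) as (All.zipWith (λ (u , v) → u ∷ v) (distinct , p∤as)) distincts
    ]′ (prime-∣-* pp (ρ cs (- a)) _ (subst (+ p ∣_) reduce p∣))
    where
    rs = map ρ (newton (a ∷ cs) as)
    reduce : det (map ρ (newton cs (a ∷ as))) (map -_ (a ∷ as)) ≡ ρ cs (- a) * det rs (map -_ as)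
    reduce = trans
      (cong (λ u → ρ cs (- a) * det rs (map -_ as) - u)
        (Linear.zero-on (lap-linear (ρ cs) (map -_ as))
          (λ zs → det-zero-column rs (- a) zs (newton-roots as (here refl)))))
      (ℤ.+-identityʳ _)

  -- The bound on the order

  ρ-∣ : ∀ {d x c cs} → c ∈ cs → d ∣ c + x → d ∣ ρ cs x
  ρ-∣ {x = x} {cs = c ∷ cs} (here refl) d∣  = ∣m⇒∣m*n (ρ cs x) d∣
  ρ-∣ {x = x} {cs = c ∷ cs} (there c∈)  d∣  = ∣n⇒∣m*n (c + x) (ρ-∣ c∈ d∣)

  -- The test polynomial is ∏ (σ + z - r) over 0 < r < p.
  order-bound : ∀ {p} → Prime p → p ≢ 2 → ∀ bss →
    All (AllPairs (λ c a → ¬ (+ p ∣ c - a))) bss →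
    (∀ {I} → I ⊆ concat bss → I ≢ [] → ¬ (+ p ∣ total I)) →
    order bss ℕ.≤ p ℕ.∸ 1
  order-bound {zero}  pp _ _ _ _ = contradiction pp ¬prime[0]
  order-bound {suc q} pp p≢2 bss distinct zsf = ℕ.≮⇒≥ λ q<order →
    blockSum-∤ pp bss (All.map (λ {as} → newton-∤ pp [] as (All.universal (λ _ → []) as)) distinct)
      others last
      -- The test polynomial has q = p - 1 factors, so an order above q makes the whole sum 0, hence
      -- divisible by p.
      (subst (P ∣_)
        (sym (blockSum-ρ bss cs (subst (ℕ._< order bss) (sym (List.length-applyUpTo root q)) q<order)))
        (divides 0ℤ refl))
    where
    P = + suc q
    σ = total (concat bss)
    root : ℕ → ℤ
    root i = σ - + suc i
    cs = applyUpTo root q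

    -- At -σ the factors are -r with 0 < r < p.
    last : ¬ (P ∣ ρ cs (- σ))
    last = ρ-∤ pp cs (All.applyUpTo⁺₁ root q (λ {i} i<q P∣ →
      ℕ.>⇒∤ (s≤s i<q) (∣⇒∣ᵤ (subst (P ∣_) (cancel σ (+ suc i)) P∣))))
      where
      cancel : ∀ σ r → (σ - r) + - σ ≡ - r
      cancel = solve-∀

    P∤2 : ¬ (P ∣ + 2)
    P∤2 P∣2 with ℕ.∣⇒≤ (∣⇒∣ᵤ P∣2)
    ... | s≤s z≤n = contradiction pp ¬prime[1]
    ... | s≤s (s≤s z≤n) = p≢2 refl

    others : ∀ {I} → I ⊆ concat bss → I ≢ [] → ∀ z → SignedSum (concat bss) I z → P ∣ ρ cs z
    others {I} I⊆ I≢[] z (signed eq) with t ℤ.%ℕ suc q | ℤ.n%ℕd<d t (suc q) | ℤ.a≡a%ℕn+[a/ℕn]*n t (suc q)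
      where t = total I + total I
    -- Residue 0 would make p divide twice `total I`, hence, p being odd, `total I` itself.
    ... | zero | _ | t≡ = contradiction
      (prime-∣-* pp (+ 2) (total I) (divides ((total I + total I) ℤ./ℕ suc q)
        (trans (double (total I)) (trans t≡ (ℤ.+-identityˡ _)))))
      [ P∤2 , zsf I⊆ I≢[] ]′
      where
      double : ∀ u → + 2 * u ≡ u + u
      double = solve-∀
    -- A nonzero residue `suc i` of z + σ is the one excluded by the factor of index `i`.
    ... | suc i | s≤s i<q | t≡ = ρ-∣ (∈-applyUpTo⁺ root i<q) (divides k (begin
      (σ - + suc i) + z            ≡⟨ regroup σ (+ suc i) z ⟩
      (z + σ) - + suc i            ≡⟨ cong (_- + suc i) (trans eq t≡) ⟩
      (+ suc i + k * P) - + suc i  ≡⟨ cancel (+ suc i) (k * P) ⟩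
      k * P                        ∎))
      where
      open ≡-Reasoning
      k = (total I + total I) ℤ./ℕ suc q
      regroup : ∀ s r z → (s - r) + z ≡ (z + s) - r
      regroup = solve-∀
      cancel : ∀ r u → (r + u) - r ≡ u
      cancel = solve-∀

  -- Partition into sets

  insert-block : ∀ {z : A} {bss} → Any (z ∉_) bss → All Unique bss →
    ∃ λ css → length css ≡ length bss × All Unique css × z ∷ concat bss ↭ concat css
  insert-block {z = z} {bs ∷ bss} (here z∉bs) (u ∷ us) =
    (z ∷ bs) ∷ bss , refl , (All.¬Any⇒All¬ bs z∉bs ∷ u) ∷ us , ↭-refl
  insert-block {z = z} {bs ∷ bss} (there z∉) (u ∷ us)
    with css , len , us′ , p ← insert-block z∉ us =
    bs ∷ css , cong suc len , u ∷ us′ , ↭-trans (↭-sym (shift z bs (concat bss))) (++⁺ˡ bs p)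

  module _ {p : ℕ} where

    count : Fin p → List (Fin p) → ℕ
    count y = length ∘ filter (y Fin.≟_)

    mult≡count : ∀ {n} y (S : Vec (Fin p) n) → mult y S ≡ count y (toList S)
    mult≡count y []      = refl
    mult≡count y (x ∷ S) with y Fin.≟ x
    ... | yes _ = cong suc (mult≡count y S)
    ... | no _  = mult≡count y S

    count-concat : ∀ y bss → All (y ∈_) bss → length bss ℕ.≤ count y (concat bss)
    count-concat y []         []         = z≤n
    count-concat y (bs ∷ bss) (y∈ ∷ y∈s) = begin
      suc (length bss)                           ≤⟨ ℕ.+-mono-≤ (nonempty (∈-filter⁺ (y Fin.≟_) y∈ refl))
                                                               (count-concat y bss y∈s) ⟩
      count y bs ℕ.+ count y (concat bss)        ≡⟨ List.length-++ (filter (y Fin.≟_) bs) ⟨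
      length (filter (y Fin.≟_) bs ++ filter (y Fin.≟_) (concat bss))
                                                 ≡⟨ cong length (List.filter-++ (y Fin.≟_) bs (concat bss)) ⟨
      count y (bs ++ concat bss)                 ∎
      where
      open ℕ.≤-Reasoning
      nonempty : ∀ {x : Fin p} {xs} → x ∈ xs → 1 ℕ.≤ length xs
      nonempty (here _)  = s≤s z≤n
      nonempty (there _) = s≤s z≤n

    mult-tail : ∀ {n} y x (S : Vec (Fin p) n) → mult y S ℕ.≤ mult y (x ∷ S)
    mult-tail y x S with y Fin.≟ x
    ... | yes _ = ℕ.n≤1+n _
    ... | no _  = ℕ.≤-refl

    mult-head : ∀ {n} x (S : Vec (Fin p) n) → mult x (x ∷ S) ≡ suc (mult x S)
    mult-head x S with x Fin.≟ x
    ... | yes _  = refl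
    ... | no x≢x = contradiction refl x≢x

    -- Greedy choice, starting from `m` empty blocks: x goes into a block without x. If there is
    -- none, x already occurs in all `m` blocks, and one more copy would exceed the bound on its
    -- multiplicity.
    set-partition : ∀ {n} (S : Vec (Fin p) n) m → (∀ y → mult y S ℕ.≤ m) →
      ∃ λ bss → length bss ≡ m × All Unique bss × toList S ↭ concat bss
    set-partition [] m _ =
      replicate m [] , List.length-replicate m , All.replicate⁺ m [] , ↭-reflexive (sym (empty m))
      where
      empty : ∀ m → concat (replicate m []) ≡ ([] {A = Fin p})
      empty zero    = refl
      empty (suc m) = empty m
    set-partition (x ∷ S) m bounded
      with bss , len , us , S↭ ← set-partition S m (λ y → ℕ.≤-trans (mult-tail y x S) (bounded y))
      with Any.any? (λ bs → ¬? (Any.any? (x Fin.≟_) bs)) bss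
    ... | yes x∉ with css , len′ , us′ , p ← insert-block x∉ us =
      css , trans len′ len , us′ , ↭-trans (↭-prep x S↭) p
    ... | no ¬x∉ = contradiction (bounded x) (ℕ.<⇒≱ (begin-strict
      m                         ≡⟨ len ⟨
      length bss                ≤⟨ count-concat x bss (All.map (decidable-stable (Any.any? (x Fin.≟_) _))
                                                             (All.¬Any⇒All¬ bss ¬x∉)) ⟩
      count x (concat bss)      ≡⟨ ↭-length (filter-↭ (x Fin.≟_) S↭) ⟨
      count x (toList S)        ≡⟨ mult≡count x S ⟨
      mult x S                  <⟨ ℕ.n<1+n _ ⟩
      suc (mult x S)            ≡⟨ mult-head x S ⟨
      mult x (x ∷ S)            ∎))
      where open ℕ.≤-Reasoning

    mult-positive : ∀ {n} y (S : Vec (Fin p) n) → 0 ℕ.< mult y S → y V.∈ S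
    mult-positive y (x ∷ S) pos with y Fin.≟ x
    ... | yes y≡x = VAny.here y≡x
    ... | no _    = VAny.there (mult-positive y S pos)

    maximiser : ∀ {n} (f : Fin p → ℕ) (S : Vec (Fin p) (suc n)) →
                ∃ λ x → x V.∈ S × (∀ {y} → y V.∈ S → f y ℕ.≤ f x)
    maximiser f (x ∷ []) = x , VAny.here refl , λ { (VAny.here refl) → ℕ.≤-refl }
    maximiser f (x ∷ S@(_ ∷ _)) with x′ , x′∈ , max ← maximiser f S with ℕ.≤-total (f x) (f x′)
    ... | inj₁ le = x′ , VAny.there x′∈ , λ { (VAny.here refl) → le ; (VAny.there y∈) → max y∈ }
    ... | inj₂ ge = x , VAny.here refl ,
      λ { (VAny.here refl) → ℕ.≤-refl ; (VAny.there y∈) → ℕ.≤-trans (max y∈) ge }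

    -- The maximum is sought among the entries of `S`, so that x lies in `S`; all other residues
    -- have multiplicity 0.
    most-frequent : ∀ {n} (S : Vec (Fin p) (suc n)) → ∃ λ x → x V.∈ S × (∀ y → mult y S ℕ.≤ mult x S)
    most-frequent S with x , x∈ , max ← maximiser (λ y → mult y S) S = x , x∈ , bound
      where
      bound : ∀ y → mult y S ℕ.≤ mult x S
      bound y with 0 ℕ.<? mult y S
      ... | yes pos = max (mult-positive y S pos)
      ... | no ¬pos = ℕ.≤-trans (ℕ.≮⇒≥ ¬pos) z≤n

  -- Residues as integers

    ι : Fin p → ℤ
    ι x = + toℕ x

    ι-∤ : ∀ {x y} → x ≢ y → ¬ (+ p ∣ ι x - ι y)
    ι-∤ {x} {y} x≢y p∣ = x≢y (Fin.toℕ-injective (ℤ.+-injective (ℤ.i-j≡0⇒i≡j (ι x) (ι y)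
      (ℤ.∣i∣≡0⇒i≡0 (small-multiple (∣⇒∣ᵤ p∣) (begin-strict
        ℤ.∣ ι x - ι y ∣           ≡⟨ cong ℤ.∣_∣ (ℤ.[+m]-[+n]≡m⊖n (toℕ x) (toℕ y)) ⟩
        ℤ.∣ toℕ x ℤ.⊖ toℕ y ∣     ≤⟨ ℤ.∣m⊝n∣≤m⊔n (toℕ x) (toℕ y) ⟩
        toℕ x ℕ.⊔ toℕ y           <⟨ ℕ.⊔-lub (Fin.toℕ<n x) (Fin.toℕ<n y) ⟩
        p                         ∎))))))
      where
      open ℕ.≤-Reasoning
      small-multiple : ∀ {m} → p ℕ.∣ m → m ℕ.< p → m ≡ 0
      small-multiple {zero}  _   _   = refl
      small-multiple {suc _} p∣m m<p = contradiction (ℕ.∣⇒≤ p∣m) (ℕ.<⇒≱ m<p)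

    ∣-% : .{{_ : NonZero p}} → ∀ m → + p ∣ + m - + (m ℕ.% p)
    ∣-% m = divides (+ (m ℕ./ p)) (begin
      + m - + (m ℕ.% p)                                   
        ≡⟨ cong (λ u → + u - + (m ℕ.% p)) (ℕ.m≡m%n+[m/n]*n m p) ⟩
      + (m ℕ.% p ℕ.+ m ℕ./ p ℕ.* p) - + (m ℕ.% p)         ≡⟨ cong (_- + (m ℕ.% p)) (ℤ.pos-+ (m ℕ.% p) _) ⟩
      (+ (m ℕ.% p) + + (m ℕ./ p ℕ.* p)) - + (m ℕ.% p)     ≡⟨ cancel (+ (m ℕ.% p)) _ ⟩
      + (m ℕ./ p ℕ.* p)                                   ≡⟨ ℤ.pos-* (m ℕ./ p) p ⟩
      + (m ℕ./ p) * + p                                   ∎)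
      where
      open ≡-Reasoning
      cancel : ∀ r u → (r + u) - r ≡ u
      cancel = solve-∀

    toℕ-0ₚ : .{{_ : NonZero p}} → toℕ (0ₚ {p}) ≡ 0
    toℕ-0ₚ = trans (Fin.toℕ-fromℕ< _) (ℕ.m*n%n≡0 0 p)

    -- Passes from integer sums to sums in `Fin p`: each `+ₚ` changes the integer by a multiple of
    -- p.
    sublist-subsum : .{{_ : NonZero p}} → ∀ {n} (S : Vec (Fin p) n) {I} → I ⊆ map ι (toList S) →
      ∃ λ J → (I ≢ [] → Nonempty J) × + p ∣ total I - ι (subsum S J)
    sublist-subsum [] [] = [] , contradiction refl ,
      subst (λ m → + p ∣ 0ℤ - + m) (sym toℕ-0ₚ) (divides 0ℤ refl)
    sublist-subsum (x ∷ S) (_ ∷ʳ I⊆) with J , ne , p∣ ← sublist-subsum S I⊆ =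
      false ∷ J , (λ I≢[] → let i , i∈J = ne I≢[] in Fin.suc i , Vec.there i∈J) , p∣
    sublist-subsum (x ∷ S) {_ ∷ I} (refl ∷ I⊆) with J , ne , p∣ ← sublist-subsum S I⊆ =
      true ∷ J , (λ _ → Fin.zero , Vec.here) ,
      subst (+ p ∣_) rearranged (∣m∣n⇒∣m+n p∣ (∣-% (toℕ x ℕ.+ toℕ (subsum S J))))
      where
      regroup : ∀ t s x r → (t - s) + ((x + s) - r) ≡ (x + t) - r
      regroup = solve-∀
      rearranged : (total I - ι (subsum S J))
                     + (+ (toℕ x ℕ.+ toℕ (subsum S J)) - + ((toℕ x ℕ.+ toℕ (subsum S J)) ℕ.% p))
                 ≡ (ι x + total I) - ι (x +ₚ subsum S J)
      rearranged = trans (regroup (total I) (ι (subsum S J)) (ι x) _)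
        (cong (λ m → (ι x + total I) - + m) (sym (Fin.toℕ-fromℕ< _)))

    zeroSumFree-total : .{{_ : NonZero p}} → ∀ {n} (S : Vec (Fin p) n) → ZeroSumFree S →
      ∀ {I} → I ⊆ map ι (toList S) → I ≢ [] → ¬ (+ p ∣ total I)
    zeroSumFree-total S zsf {I} I⊆ I≢[] p∣I with J , ne , p∣ ← sublist-subsum S I⊆ =
      zsf J (ne I≢[]) (decidable-stable (_ Fin.≟ _) (λ s≢0 → ι-∤ s≢0
        (subst (λ u → + p ∣ ι (subsum S J) - + u) (sym toℕ-0ₚ)
          (subst (+ p ∣_) (difference (total I) (ι (subsum S J))) (∣m∣n⇒∣m-n p∣I p∣)))))
      where
      difference : ∀ t s → t - (t - s) ≡ s - 0ℤ
      difference = solve-∀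

  -- From the sequence to its blocks

  -- The blocks list the terms of the sequence in another order, so their sublists are pulled back
  -- to it. Agreement up to permutation suffices, because only totals matter.
  ⊆-↭ : ∀ {ms ns I : List A} → ms ↭ ns → I ⊆ ns → ∃ λ J → J ⊆ ms × J ↭ I
  ⊆-↭ ↭.refl I⊆ = _ , I⊆ , ↭-refl
  ⊆-↭ (↭.prep x p) (_ ∷ʳ I⊆) with J , J⊆ , q ← ⊆-↭ p I⊆ = J , x ∷ʳ J⊆ , q
  ⊆-↭ (↭.prep x p) (refl ∷ I⊆) with J , J⊆ , q ← ⊆-↭ p I⊆ = x ∷ J , refl ∷ J⊆ , ↭-prep x q
  ⊆-↭ (↭.swap x y p) (_ ∷ʳ _ ∷ʳ I⊆) with J , J⊆ , q ← ⊆-↭ p I⊆ = J , x ∷ʳ y ∷ʳ J⊆ , q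
  ⊆-↭ (↭.swap x y p) (_ ∷ʳ refl ∷ I⊆) with J , J⊆ , q ← ⊆-↭ p I⊆ = x ∷ J , refl ∷ y ∷ʳ J⊆ , ↭-prep x q
  ⊆-↭ (↭.swap x y p) (refl ∷ _ ∷ʳ I⊆) with J , J⊆ , q ← ⊆-↭ p I⊆ = y ∷ J , x ∷ʳ refl ∷ J⊆ , ↭-prep y q
  ⊆-↭ (↭.swap x y p) (refl ∷ refl ∷ I⊆) with J , J⊆ , q ← ⊆-↭ p I⊆ = x ∷ y ∷ J , refl ∷ refl ∷ J⊆ , ↭.swap x y q
  ⊆-↭ (↭.trans p p′) I⊆ with J , J⊆ , q ← ⊆-↭ p′ I⊆ with K , K⊆ , q′ ← ⊆-↭ p J⊆ = K , K⊆ , ↭-trans q′ q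

  total-↭ : ∀ {xs ys} → xs ↭ ys → total xs ≡ total ys
  total-↭ ↭.refl         = refl
  total-↭ (↭.prep x p)   = cong (λ u → x + u) (total-↭ p)
  total-↭ (↭.swap x y p) = trans (exchange x y _) (cong (λ u → y + (x + u)) (total-↭ p))
    where
    exchange : ∀ x y z → x + (y + z) ≡ y + (x + z)
    exchange = solve-∀
  total-↭ (↭.trans p q)  = trans (total-↭ p) (total-↭ q)

  partition-order : ∀ {p} .{{_ : NonZero p}} → Prime p → p ≢ 2 →
    ∀ {n} (S : Vec (Fin p) n) → ZeroSumFree S →
    ∀ bss → All Unique bss → toList S ↭ concat bss → order (map (map ι) bss) ℕ.≤ p ℕ.∸ 1
  partition-order {p} pp p≢2 S zsf bss us S↭ = order-bound pp p≢2 (map (map ι) bss)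
    (All.map⁺ (All.map (λ u → AllPairs.map⁺ (AllPairs.map ι-∤ u)) us)) zsf′
    where
    S↭ℤ : map ι (toList S) ↭ concat (map (map ι) bss)
    S↭ℤ = ↭-trans (map⁺ ι S↭) (↭-reflexive (sym (List.concat-map bss)))
    zsf′ : ∀ {I} → I ⊆ concat (map (map ι) bss) → I ≢ [] → ¬ (+ p ∣ total I)
    zsf′ I⊆ I≢[] p∣I with J , J⊆ , J↭I ← ⊆-↭ S↭ℤ I⊆ =
      zeroSumFree-total S zsf J⊆ (λ { refl → I≢[] (↭-empty-inv (↭-sym J↭I)) })
        (subst (+ p ∣_) (sym (total-↭ J↭I)) p∣I)

  -- Optimisation over the block sizes

  2*triangle : ∀ d → 2 ℕ.* triangle d ≡ d ℕ.* suc d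
  2*triangle zero    = refl
  2*triangle (suc d) = trans (lemma₁ d (triangle d)) (trans (cong (2 ℕ.* suc d ℕ.+_) (2*triangle d)) (lemma₂ d))
    where
    lemma₁ : ∀ d t → 2 ℕ.* (suc d ℕ.+ t) ≡ 2 ℕ.* suc d ℕ.+ 2 ℕ.* t
    lemma₁ = ℕ-Solver.solve-∀
    lemma₂ : ∀ d → 2 ℕ.* suc d ℕ.+ d ℕ.* suc d ≡ suc d ℕ.* suc (suc d)
    lemma₂ = ℕ-Solver.solve-∀

  -- The difference of the two sides is (k - d)(k + 1 - d) ≥ 0.
  triangle-tangent : ∀ k d → 2 ℕ.* (k ℕ.+ 1) ℕ.* d ℕ.≤ k ℕ.* (k ℕ.+ 1) ℕ.+ 2 ℕ.* triangle d
  triangle-tangent k d rewrite 2*triangle d = [ below , above ]′ (ℕ.≤-<-connex d k)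
    where
    below : d ℕ.≤ k → 2 ℕ.* (k ℕ.+ 1) ℕ.* d ℕ.≤ k ℕ.* (k ℕ.+ 1) ℕ.+ d ℕ.* suc d
    below d≤k with e , refl ← ℕ.m≤n⇒∃[o]m+o≡n d≤k =
      ℕ.≤-trans (ℕ.m≤m+n _ (e ℕ.* suc e)) (ℕ.≤-reflexive (identity d e))
      where
      identity : ∀ d e → 2 ℕ.* (d ℕ.+ e ℕ.+ 1) ℕ.* d ℕ.+ e ℕ.* suc e ≡
                         (d ℕ.+ e) ℕ.* (d ℕ.+ e ℕ.+ 1) ℕ.+ d ℕ.* suc d
      identity = ℕ-Solver.solve-∀
    above : k ℕ.< d → 2 ℕ.* (k ℕ.+ 1) ℕ.* d ℕ.≤ k ℕ.* (k ℕ.+ 1) ℕ.+ d ℕ.* suc d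
    above k<d with e , refl ← ℕ.m≤n⇒∃[o]m+o≡n k<d =
      ℕ.≤-trans (ℕ.m≤m+n _ (e ℕ.* suc e)) (ℕ.≤-reflexive (identity k e))
      where
      identity : ∀ k e → 2 ℕ.* (k ℕ.+ 1) ℕ.* (suc k ℕ.+ e) ℕ.+ e ℕ.* suc e ≡
                         k ℕ.* (k ℕ.+ 1) ℕ.+ (suc k ℕ.+ e) ℕ.* suc (suc k ℕ.+ e)
      identity = ℕ-Solver.solve-∀

  -- `triangle-tangent` summed over the blocks, with equality when all sizes are `k` or `k + 1`.
  -- Empty blocks count too, so the constant term is multiplied by the exact number of blocks.
  order-tangent : ∀ k bss → 2 ℕ.* (k ℕ.+ 1) ℕ.* length (concat bss) ℕ.≤
                            k ℕ.* (k ℕ.+ 1) ℕ.* length bss ℕ.+ 2 ℕ.* order bss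
  order-tangent k []         rewrite ℕ.*-zeroʳ (2 ℕ.* (k ℕ.+ 1)) = z≤n
  order-tangent k (as ∷ bss) = begin
    c ℕ.* length (as ++ concat bss)                    ≡⟨ cong (c ℕ.*_) (List.length-++ as) ⟩
    c ℕ.* (length as ℕ.+ length (concat bss))          ≡⟨ ℕ.*-distribˡ-+ c (length as) _ ⟩
    c ℕ.* length as ℕ.+ c ℕ.* length (concat bss)
      ≤⟨ ℕ.+-mono-≤ (triangle-tangent k (length as)) (order-tangent k bss) ⟩
    (e ℕ.+ 2 ℕ.* t) ℕ.+ (e ℕ.* length bss ℕ.+ 2 ℕ.* order bss)
      ≡⟨ regroup e t (length bss) (order bss) ⟩
    e ℕ.* suc (length bss) ℕ.+ 2 ℕ.* (t ℕ.+ order bss) ∎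
    where
    open ℕ.≤-Reasoning
    c = 2 ℕ.* (k ℕ.+ 1)
    e = k ℕ.* (k ℕ.+ 1)
    t = triangle (length as)
    regroup : ∀ e t l o → (e ℕ.+ 2 ℕ.* t) ℕ.+ (e ℕ.* l ℕ.+ 2 ℕ.* o) ≡ e ℕ.* suc l ℕ.+ 2 ℕ.* (t ℕ.+ o)
    regroup = ℕ-Solver.solve-∀

-- The multiplicity bound

open SignedSums using (ι; order; most-frequent; set-partition; partition-order; order-tangent)
open import Data.Nat using (ℕ; suc; _+_; _*_; _≤_; _∸_; NonZero)
open import Data.Vec.Membership.Propositional using (_∈_)

-- The inequality is cleared of denominators by the positive factor k(k+1), with the subtracted term
-- moved to the right. The ceiling is implicit, as a multiplicity is an integer.
theorem7 : (p : ℕ) → Prime p → p ≢ 2 → .{{_ : NonZero p}} →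
    (n : ℕ) → 1 ≤ n → (S : Vec (Fin p) n) → ZeroSumFree S →
    (k : ℕ) → 1 ≤ k →
    ∃ λ (x : Fin p) → x ∈ S ×
    2 * (k + 1) * n ≤ k * (k + 1) * mult x S + 2 * (p ∸ 1)
theorem7 p p-prime p≢2 (suc n) _ S zsf k _
  with x , x∈S , max ← most-frequent S
  with bss , len , us , S↭ ← set-partition S (mult x S) max = x , x∈S , (begin
  c * suc n                               ≡⟨ cong (c *_) size ⟩
  c * length (concat ℤss)                 ≤⟨ order-tangent k ℤss ⟩
  e * length ℤss + 2 * order ℤss          ≡⟨ cong (λ l → e * l + 2 * order ℤss) blocks ⟩
  e * mult x S + 2 * order ℤss            ≤⟨ ℕ.+-monoʳ-≤ (e * mult x S) (ℕ.*-monoʳ-≤ 2 bound) ⟩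
  e * mult x S + 2 * (p ∸ 1)              ∎)
  where
  open ℕ.≤-Reasoning
  c = 2 * (k + 1)
  e = k * (k + 1)
  ℤss = map (map ι) bss
  blocks : length ℤss ≡ mult x S
  blocks = trans (List.length-map (map ι) bss) len
  size : suc n ≡ length (concat ℤss)
  size = trans (sym (Vec.length-toList S)) (trans (↭-length S↭)
    (trans (sym (List.length-map ι (concat bss))) (cong length (sym (List.concat-map bss)))))
  bound : order ℤss ≤ p ∸ 1
  bound = partition-order p-prime p≢2 S zsf bss us S↭
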